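{- Let $G=(V,E)$ be an undirected capacitated graph with terminal set $K\subset V$, $|K|=k$, which has unique minimum terminal cuts. Let $H$ be the mimicking network for $(G,K)$ produced by the Exact-Cut-Sparsifier algorithm (described in the context). Then $H$ is optimal among contraction-based mimicking networks for $(G,K)$: every contraction-based mimicking network $H'$ of $(G,K)$ satisfies $|V_{H'}|\ge |V_H|$.
   Context: Graphs are finite, undirected, with edge capacities $c:E\to\mathbb{R}^+$. The cut function is $h_G(A)=\sum_{e\in\delta(A)}c(e)$ for $A\subseteq V$, where $\delta(A)$ is the set of edges with exactly one endpoint in $A$. For $U\subseteq K$, the terminal cut function is $h_K^G(U)=\min\{h_G(A): A\subseteq V,\ A\cap K=U\}$. A minimum terminal cut separating $U$ from $K\setminus U$ is a partition $\{A,V\setminus A\}$ with $A\cap K=U$ and $h_G(A)=h_K^G(U)$. $G$ has unique minimum terminal cuts if for every nonempty proper subset $U$ of $K$ there is exactly one such partition. A mimicking network for $(G,K)$ is an undirected capacitated graph $H=(V_H,E_H)$ with $K\subseteq V_H$ such that $h_K^H(U)=h_K^G(U)$ for every $U\subset K$. A mimicking network $H=(V_H,E_H)$ is contraction-based if there is a function $f:V\to V_H$, with $f(v)=v$ for every terminal $v\in K$, such that the edge capacities of $H$ are $c_H(y,z)=\sum_{(u,v)\in E:\ f(u)=y,\ f(v)=z}c(u,v)$ for distinct $y,z\in V_H$. Exact-Cut-Sparsifier algorithm: given $G$ and $K$, compute a minimum terminal cut for each of the $2^{k-1}-1$ bipartitions $\{U,K\setminus U\}$ of $K$ into two nonempty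 parts; partition $V$ into clusters, where two vertices are in the same cluster if and only if they lie on the same side of every one of these minimum terminal cuts; contract each nonempty cluster to a single node (the capacity between two nodes is the sum of the capacities of edges of $G$ between the two clusters, and each terminal is identified with the node of its cluster); return the resulting graph $H$. -}

module Defs where

open import Algebra.Bundles using (CommutativeRing)
import Algebra.Properties.CommutativeMonoid.Sum as Sum
open import Data.Bool.Base using (if_then_else_; _∧_; not)
import Data.Bool.Properties as Bool
open import Data.Fin.Base using (Fin)
import Data.Fin.Properties as Fin
open import Data.Fin.Subset using (Subset; Nonempty; ∁; inside; outside)
open import Data.Fin.Subset.Properties using (_∈?_)
open import Data.List.Base using (List; []; _∷_; _++_; map; filter)
import Data.List.Extrema as Extrema
open import Data.Nat.Base as ℕ using (ℕ; zero; suc)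
open import Data.Product using (∃; ∃-syntax; ∃!; _×_)
import Data.Vec.Base as Vec
import Data.Vec.Properties as Vec
open import Function.Bundles using (_⇔_)
open import Function.Definitions using (Injective; Surjective)
open import Level using (_⊔_; 0ℓ) renaming (suc to lsuc)
open import Relation.Binary.Bundles using (TotalOrder)
open import Relation.Binary.Core using (Rel)
open import Relation.Binary.Definitions using (Decidable; Irreflexive; Symmetric)
open import Relation.Binary.PropositionalEquality using (_≡_; _≢_)
open import Relation.Binary.Structures using (IsTotalOrder)
import Relation.Binary.Construct.NonStrictToStrict as NonStrictToStrict
open import Relation.Nullary.Negation using (¬_)
open import Relation.Nullary.Decidable using (does; _×-dec_)

-- Stands in for the real numbers, which are one such field: capacities
-- are taken in an arbitrary totally ordered field.
record OrderedField c ℓ₁ ℓ₂ : Set (lsuc (c ⊔ ℓ₁ ⊔ ℓ₂)) where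
  infix 4 _≤_
  field
    commutativeRing : CommutativeRing c ℓ₁
  open CommutativeRing commutativeRing public
  field
    0≉1           : ¬ (0# ≈ 1#)
    inverse       : ∀ x → ¬ (x ≈ 0#) → ∃[ y ] x * y ≈ 1#
    _≤_           : Rel Carrier ℓ₂
    isTotalOrder  : IsTotalOrder _≈_ _≤_
    +-monoˡ-≤     : ∀ x {y z} → y ≤ z → y + x ≤ z + x
    *-nonneg      : ∀ {x y} → 0# ≤ x → 0# ≤ y → 0# ≤ x * y

  totalOrder : TotalOrder c ℓ₁ ℓ₂
  totalOrder = record { isTotalOrder = isTotalOrder }

  open NonStrictToStrict _≈_ _≤_ public using (_<_)

allSubsets : ∀ n → List (Subset n)
allSubsets zero    = Vec.[] ∷ []
allSubsets (suc n) = map (outside Vec.∷_) (allSubsets n)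
                  ++ map (inside Vec.∷_) (allSubsets n)

NonemptyProper : ∀ {k} → Subset k → Set
NonemptyProper U = Nonempty U × Nonempty (∁ U)

module _ {c ℓ₁ ℓ₂} (R : OrderedField c ℓ₁ ℓ₂) where

  open OrderedField R using (Carrier; _≈_; _<_; 0#; totalOrder; +-commutativeMonoid)
  open Sum +-commutativeMonoid using (sum-syntax)
  open Extrema totalOrder using (min)

  -- The capacity function is defined on E with positive values, and extended
  -- by 0 to the pairs of vertices that are not edges.
  record Graph (n : ℕ) : Set (lsuc 0ℓ ⊔ c ⊔ ℓ₁ ⊔ ℓ₂) where
    field
      E           : Rel (Fin n) 0ℓ
      E?          : Decidable E
      E-sym       : Symmetric E
      E-irrefl    : Irreflexive _≡_ E
      cap         : Fin n → Fin n → Carrier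
      cap-sym     : ∀ u v → cap u v ≈ cap v u
      cap-edge    : ∀ {u v} → E u v → 0# < cap u v
      cap-nonedge : ∀ {u v} → ¬ E u v → cap u v ≈ 0#

    -- An edge of δ(A) is counted once, oriented from its endpoint in A to its
    -- endpoint outside A.
    h : Subset n → Carrier
    h A = ∑[ u < n ] ∑[ v < n ]
            (if Vec.lookup A u ∧ not (Vec.lookup A v) then cap u v else 0#)

  -- A graph whose vertex set contains K, where K = Fin k is embedded by
  -- `terminal`; subsets of K are elements of Subset k.  Sharing k between two
  -- networks expresses that they have the same terminals.
  record Network (k : ℕ) : Set (lsuc 0ℓ ⊔ c ⊔ ℓ₁ ⊔ ℓ₂) where
    field
      ∣V∣           : ℕ
      graph         : Graph ∣V∣
      terminal      : Fin k → Fin ∣V∣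
      terminal-inj  : Injective _≡_ _≡_ terminal
    open Graph graph public

    _∩K : Subset ∣V∣ → Subset k
    A ∩K = Vec.tabulate (λ i → Vec.lookup A (terminal i))

    embed : Subset k → Subset ∣V∣
    embed U = Vec.tabulate λ v →
      does (Fin.any? λ i → (terminal i Fin.≟ v) ×-dec (i ∈? U))

    -- `min` takes a default element; `embed U` is itself one of the sets A
    -- with A ∩ K = U, so this is the minimum of h over exactly those sets.
    h-K : Subset k → Carrier
    h-K U = min (h (embed U))
                (map h (filter (λ A → Vec.≡-dec Bool._≟_ (A ∩K) U) (allSubsets ∣V∣)))

    -- The partition {A , V ∖ A} is represented by its side A meeting K in U.
    -- For K nonempty only one of the two sides does so, hence distinct sets A
    -- represent distinct partitions.
    IsMinimumTerminalCut : Subset k → Subset ∣V∣ → Set ℓ₁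
    IsMinimumTerminalCut U A = A ∩K ≡ U × h A ≈ h-K U

    UniqueMinimumTerminalCuts : Set ℓ₁
    UniqueMinimumTerminalCuts =
      ∀ U → NonemptyProper U → ∃! _≡_ (IsMinimumTerminalCut U)

  open Network

  IsMimickingNetwork : ∀ {k} → Network k → Network k → Set ℓ₁
  IsMimickingNetwork G H = ∀ U → h-K H U ≈ h-K G U

  -- For y ≢ z an edge {u , v} of G with f u ≡ y and f v ≡ z contributes to the
  -- sum in only one of its two orientations.
  record IsContraction {k} (G H : Network k) (f : Fin (∣V∣ G) → Fin (∣V∣ H))
         : Set ℓ₁ where
    field
      on-terminals : ∀ i → f (terminal G i) ≡ terminal H i
      capacities   : ∀ y z → y ≢ z →
        cap H y z ≈ ∑[ u < ∣V∣ G ] ∑[ v < ∣V∣ G ]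
          (if does (f u Fin.≟ y) ∧ does (f v Fin.≟ z) then cap G u v else 0#)

  IsContractionBasedMimickingNetwork : ∀ {k} → Network k → Network k → Set ℓ₁
  IsContractionBasedMimickingNetwork G H =
    IsMimickingNetwork G H × ∃ (IsContraction G H)

  -- One minimum terminal cut per bipartition {U , K ∖ U}: the choices made for
  -- U and for K ∖ U are the two sides of the same partition of V.  The values
  -- of `cut` at ∅ and K carry no information.
  record MinimumTerminalCutChoice {k} (G : Network k) : Set ℓ₁ where
    field
      cut         : Subset k → Subset (∣V∣ G)
      cut-minimum : ∀ U → NonemptyProper U → IsMinimumTerminalCut G U (cut U)
      cut-∁       : ∀ U → NonemptyProper U → cut (∁ U) ≡ ∁ (cut U)

    SameCluster : Rel (Fin (∣V∣ G)) 0ℓ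
    SameCluster u v =
      ∀ U → NonemptyProper U → Vec.lookup (cut U) u ≡ Vec.lookup (cut U) v

  -- H is a graph returned by the Exact-Cut-Sparsifier algorithm on G.  The
  -- nodes of H are the clusters: `cluster` is onto (clusters are nonempty) and
  -- its fibres are the classes of SameCluster.
  record IsExactCutSparsifier {k} (G H : Network k) : Set ℓ₁ where
    field
      choice : MinimumTerminalCutChoice G
    open MinimumTerminalCutChoice choice public
    field
      cluster       : Fin (∣V∣ G) → Fin (∣V∣ H)
      cluster-onto  : Surjective _≡_ _≡_ cluster
      cluster-fibre : ∀ u v → cluster u ≡ cluster v ⇔ SameCluster u v
      contraction   : IsContraction G H cluster

  IsOptimalContractionBased : ∀ {k} → Network k → Network k →
                              Set (lsuc 0ℓ ⊔ c ⊔ ℓ₁ ⊔ ℓ₂)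
  IsOptimalContractionBased G H =
    IsContractionBasedMimickingNetwork G H ×
    (∀ H′ → IsContractionBasedMimickingNetwork G H′ → ∣V∣ H ℕ.≤ ∣V∣ H′)

{-# OPTIONS --safe #-}

-- Pulling back along the vertex map f of a contraction G → H sends a set B of
-- vertices of H to a set with the same trace on K and the same cut value.
-- Hence h-K can only increase under contraction, and it does not increase when
-- a minimum cut of G is a union of fibres of f, as for the clusters.
-- Conversely, let H′ be any contraction-based mimicking network, with map f′.
-- A minimum terminal cut of H′ for U pulls back to a minimum terminal cut of G
-- for U, which by uniqueness is the one used by the algorithm.  Thus f′ u ≡ f′ v
-- puts u and v on the same side of all these cuts, so the clusters inject into
-- the vertices of H′.
module Submission where

open import Defs

import Algebra.Properties.CommutativeMonoid.Sum as Sum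
open import Data.Bool.Base using (Bool; true; false; not; _∧_; if_then_else_)
import Data.Bool.Properties as Bool
open import Data.Fin.Base using (Fin; zero; suc)
import Data.Fin.Properties as Fin
open import Data.Fin.Subset using (Subset; ∁; ⊥) renaming (_∈_ to _∈ₛ_)
open import Data.Fin.Subset.Properties using (_∈?_; nonempty?; Empty-unique)
open import Data.List.Base using (map; filter)
import Data.List.Extrema as Extrema
open import Data.List.Membership.Propositional using (_∈_)
open import Data.List.Membership.Propositional.Properties
  using (∈-map⁺; ∈-map⁻; ∈-++⁺ˡ; ∈-++⁺ʳ; ∈-filter⁺; ∈-filter⁻)
import Data.List.Relation.Unary.All as All
open import Data.List.Relation.Unary.Any using (here)
open import Data.Nat.Base as ℕ using (suc)
open import Data.Product using (∃; _×_; _,_; proj₁; proj₂)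
open import Data.Sum.Base using (inj₁; inj₂)
open import Data.Vec.Base using ([]; _∷_; lookup; tabulate; replicate)
import Data.Vec.Properties as Vec
open import Function.Base using (_∘_)
open import Function.Bundles using (module Equivalence)
open import Relation.Binary.Bundles using (module TotalOrder)
open import Relation.Binary.PropositionalEquality as ≡
  using (_≡_; _≢_; cong; cong₂)
open import Relation.Nullary.Decidable
  using (Dec; yes; no; does; _×-dec_; dec-true; dec-false)
open import Relation.Nullary.Negation using (¬_; contradiction)

-- Subsets of a finite set

allSubsets-complete : ∀ {n} (A : Subset n) → A ∈ allSubsets n
allSubsets-complete []          = here ≡.refl
allSubsets-complete (false ∷ A) = ∈-++⁺ˡ (∈-map⁺ _ (allSubsets-complete A))
allSubsets-complete (true  ∷ A) =
  ∈-++⁺ʳ (map (false ∷_) (allSubsets _)) (∈-map⁺ _ (allSubsets-complete A))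

-- The cuts of the algorithm concern nonempty proper sets only, while a mimicking network must agree
-- on every `U`. The remaining cases, the empty set and `K`, are treated uniformly through the
-- constant `b`.
¬NonemptyProper⇒constant :
  ∀ {k} (U : Subset k) → ¬ NonemptyProper U → ∃ λ b → ∀ i → lookup U i ≡ b
¬NonemptyProper⇒constant U ¬np with nonempty? U
... | no empty = false , λ i →
  ≡.trans (cong (λ W → lookup W i) (Empty-unique empty)) (Vec.lookup-replicate i false)
... | yes nonempty = true , λ i → Bool.not-injective (begin
  not (lookup U i)   ≡⟨ Vec.lookup-map i not U ⟨
  lookup (∁ U) i     ≡⟨ cong (λ W → lookup W i) (Empty-unique (λ ne → ¬np (nonempty , ne))) ⟩
  lookup ⊥ i         ≡⟨ Vec.lookup-replicate i false ⟩
  false              ∎)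
  where open ≡.≡-Reasoning

preimage : ∀ {m n} → (Fin m → Fin n) → Subset n → Subset m
preimage f B = tabulate (lookup B ∘ f)

module _ {c ℓ₁ ℓ₂} (R : OrderedField c ℓ₁ ℓ₂) where

  open OrderedField R hiding (_*_; zero)
  open Sum +-commutativeMonoid
  open Extrema totalOrder using (min; min≤xs; argmin-sel)
  open TotalOrder totalOrder using (antisym)
    renaming (trans to ≤-trans; reflexive to ≤-reflexive)
  open import Relation.Binary.Reasoning.Setoid setoid
  open Network
  open IsContraction

  -- Finite sums in an ordered field

  sum-zero : ∀ {n} (t : Fin n → Carrier) → (∀ i → t i ≈ 0#) → sum t ≈ 0#
  sum-zero {n} t t≈0 = trans (sum-cong-≋ t≈0) (sum-replicate-zero n)

  sum-single : ∀ {n} (t : Fin n → Carrier) i →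
               (∀ j → j ≢ i → t j ≈ 0#) → sum t ≈ t i
  sum-single t zero    t≈0 = trans
    (+-congˡ (sum-zero (t ∘ suc) (λ j → t≈0 (suc j) λ ()))) (+-identityʳ _)
  sum-single t (suc i) t≈0 = trans
    (+-cong (t≈0 zero λ ())
            (sum-single (t ∘ suc) i λ j j≢i → t≈0 (suc j) (j≢i ∘ Fin.suc-injective)))
    (+-identityˡ _)

  +-nonneg : ∀ {x y} → 0# ≤ x → 0# ≤ y → 0# ≤ x + y
  +-nonneg {x} {y} 0≤x 0≤y =
    ≤-trans 0≤y (≤-trans (≤-reflexive (sym (+-identityˡ y))) (+-monoˡ-≤ y 0≤x))

  sum-nonneg : ∀ {n} (t : Fin n → Carrier) → (∀ i → 0# ≤ t i) → 0# ≤ sum t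
  sum-nonneg {ℕ.zero} t 0≤t = ≤-reflexive refl
  sum-nonneg {suc n}  t 0≤t = +-nonneg (0≤t zero) (sum-nonneg (t ∘ suc) (0≤t ∘ suc))

  ∑∑-comm : ∀ {m n} (F : Fin n → Fin n → Fin m → Fin m → Carrier) →
            ∑[ y < n ] ∑[ z < n ] ∑[ u < m ] ∑[ v < m ] F y z u v ≈
            ∑[ u < m ] ∑[ v < m ] ∑[ y < n ] ∑[ z < n ] F y z u v
  ∑∑-comm {m} {n} F = begin
    ∑[ y < n ] ∑[ z < n ] ∑[ u < m ] ∑[ v < m ] F y z u v
      ≈⟨ sum-cong-≋ (λ y → ∑-comm λ z u → ∑[ v < m ] F y z u v) ⟩
    ∑[ y < n ] ∑[ u < m ] ∑[ z < n ] ∑[ v < m ] F y z u v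
      ≈⟨ ∑-comm (λ y u → ∑[ z < n ] ∑[ v < m ] F y z u v) ⟩
    ∑[ u < m ] ∑[ y < n ] ∑[ z < n ] ∑[ v < m ] F y z u v
      ≈⟨ sum-cong-≋ (λ u → sum-cong-≋ λ y → ∑-comm λ z v → F y z u v) ⟩
    ∑[ u < m ] ∑[ y < n ] ∑[ v < m ] ∑[ z < n ] F y z u v
      ≈⟨ sum-cong-≋ (λ u → ∑-comm λ y v → ∑[ z < n ] F y z u v) ⟩
    ∑[ u < m ] ∑[ v < m ] ∑[ y < n ] ∑[ z < n ] F y z u v ∎

  -- Cut values and minimum cuts of a single network

  module _ {k} (G : Network R k) where

    cap-nonneg : ∀ u v → 0# ≤ cap G u v
    cap-nonneg u v with E? G u v
    ... | yes e = proj₁ (cap-edge G e)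
    ... | no ¬e = ≤-reflexive (sym (cap-nonedge G ¬e))

    h-nonneg : ∀ A → 0# ≤ h G A
    h-nonneg A = sum-nonneg _ λ u → sum-nonneg _ λ v →
      term-nonneg u v (lookup A u ∧ not (lookup A v))
      where
      term-nonneg : ∀ u v b → 0# ≤ (if b then cap G u v else 0#)
      term-nonneg u v true  = cap-nonneg u v
      term-nonneg u v false = ≤-reflexive refl

    h-replicate : ∀ b → h G (replicate _ b) ≈ 0#
    h-replicate b = sum-zero _ λ u → sum-zero _ λ v → reflexive (cong (if_then cap G u v else 0#)
      (≡.trans (cong₂ (λ x y → x ∧ not y) (Vec.lookup-replicate u b) (Vec.lookup-replicate v b))
               (Bool.∧-inverseʳ b)))

    -- Makes the default element of the `min` in `h-K` a genuine competitor. Injectivity of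
    -- `terminal` prevents a terminal outside `U` from sharing its vertex with one inside.
    embed-∩K : ∀ U → _∩K G (embed G U) ≡ U
    embed-∩K U = ≡.trans
      (Vec.tabulate-cong λ i → ≡.trans (Vec.lookup∘tabulate _ (terminal G i)) (member i))
      (Vec.tabulate∘lookup U)
      where
      represented? : ∀ v → Dec (∃ λ j → terminal G j ≡ v × j ∈ₛ U)
      represented? v = Fin.any? λ j → (terminal G j Fin.≟ v) ×-dec (j ∈? U)

      member : ∀ i → does (represented? (terminal G i)) ≡ lookup U i
      member i with lookup U i in eq
      ... | true  = dec-true (represented? _) (i , ≡.refl , Vec.lookup⇒[]= i U eq)
      ... | false = dec-false (represented? _) λ (j , tj≡ti , j∈U) → contradiction
        (≡.trans (≡.sym eq)
          (≡.trans (cong (lookup U) (≡.sym (terminal-inj G tj≡ti))) (Vec.[]=⇒lookup j∈U)))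
        λ ()

    private
      -- Unfolds to the filter predicate of `h-K`, so that membership in the filtered list transfers
      -- to the list minimised there.
      Trace? : ∀ U A → Dec (_∩K G A ≡ U)
      Trace? U A = Vec.≡-dec Bool._≟_ (_∩K G A) U

    h-K-≤ : ∀ {U} A → _∩K G A ≡ U → h-K G U ≤ h G A
    h-K-≤ {U} A A∩K≡U = All.lookup (min≤xs _ _)
      (∈-map⁺ (h G) (∈-filter⁺ (Trace? U) (allSubsets-complete A) A∩K≡U))

    h-K-attained : ∀ U → ∃ (IsMinimumTerminalCut G U)
    h-K-attained U
      -- `min` is `argmin` of the identity: its value is either the default element or a member of
      -- the list.
      with argmin-sel (λ x → x) (h G (embed G U))
                      (map (h G) (filter (Trace? U) (allSubsets (∣V∣ G))))
    ... | inj₁ eq = embed G U , embed-∩K U , reflexive (≡.sym eq)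
    ... | inj₂ m∈ with ∈-map⁻ (h G) m∈
    ... | A , A∈ , eq = A , proj₂ (∈-filter⁻ (Trace? U) {xs = allSubsets _} A∈) , reflexive (≡.sym eq)

    -- All of `V` or none of it has trace `U` and cuts no edge, and no cut has negative value.
    h-K-constant : ∀ {b} U → (∀ i → lookup U i ≡ b) → h-K G U ≈ 0#
    h-K-constant {b} U U≡b = antisym
      (≤-trans (h-K-≤ (replicate _ b) trace) (≤-reflexive (h-replicate b)))
      (let A , _ , hA≈ = h-K-attained U in ≤-trans (h-nonneg A) (≤-reflexive hA≈))
      where
      trace : _∩K G (replicate _ b) ≡ U
      trace = ≡.trans
        (Vec.tabulate-cong λ i →
          ≡.trans (Vec.lookup-replicate (terminal G i) b) (≡.sym (U≡b i)))
        (Vec.tabulate∘lookup U)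

  -- Pulling back cuts along a contraction

  module _ {k} {G H : Network R k} {f : Fin (∣V∣ G) → Fin (∣V∣ H)}
           (contr : IsContraction R G H f) where

    preimage-∩K : ∀ B → _∩K G (preimage f B) ≡ _∩K H B
    preimage-∩K B = Vec.tabulate-cong λ i → ≡.trans
      (Vec.lookup∘tabulate _ (terminal G i)) (cong (lookup B) (on-terminals contr i))

    -- Expand each capacity of `H` into capacities of `G` and exchange the sums: for fixed `u` and
    -- `v` only the pair `f u`, `f v` contributes. Edges inside a fibre, which the contraction
    -- drops, never cross a pulled-back set.
    h-preimage : ∀ B → h H B ≈ h G (preimage f B)
    h-preimage B = begin
      h H B
        ≈⟨ sum-cong-≋ (λ y → sum-cong-≋ λ z → expand y z) ⟩
      ∑[ y < ∣V∣ H ] ∑[ z < ∣V∣ H ] ∑[ u < ∣V∣ G ] ∑[ v < ∣V∣ G ] F y z u v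
        ≈⟨ ∑∑-comm F ⟩
      ∑[ u < ∣V∣ G ] ∑[ v < ∣V∣ G ] ∑[ y < ∣V∣ H ] ∑[ z < ∣V∣ H ] F y z u v
        ≈⟨ sum-cong-≋ (λ u → sum-cong-≋ λ v → collapse u v) ⟩
      h G (preimage f B) ∎
      where
      crosses : Fin (∣V∣ H) → Fin (∣V∣ H) → Bool
      crosses y z = lookup B y ∧ not (lookup B z)

      over : Fin (∣V∣ H) → Fin (∣V∣ H) → Fin (∣V∣ G) → Fin (∣V∣ G) → Bool
      over y z u v = does (f u Fin.≟ y) ∧ does (f v Fin.≟ z)

      F : Fin (∣V∣ H) → Fin (∣V∣ H) → Fin (∣V∣ G) → Fin (∣V∣ G) → Carrier
      F y z u v = if crosses y z then (if over y z u v then cap G u v else 0#) else 0#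

      expand : ∀ y z → (if crosses y z then cap H y z else 0#) ≈
                       ∑[ u < ∣V∣ G ] ∑[ v < ∣V∣ G ] F y z u v
      expand y z with crosses y z in eq
      -- `capacities` covers only distinct nodes, and a pair that crosses `B` is distinct.
      ... | true  = capacities contr y z λ y≡z → contradiction
        (≡.trans (≡.sym eq)
          (≡.trans (cong (λ x → lookup B y ∧ not (lookup B x)) (≡.sym y≡z))
                   (Bool.∧-inverseʳ (lookup B y))))
        λ ()
      ... | false = sym (sum-zero {∣V∣ G} _ λ u → sum-zero {∣V∣ G} _ λ v → refl)

      F-zero : ∀ y z u v → over y z u v ≡ false → F y z u v ≈ 0#
      F-zero y z u v eq rewrite eq = reflexive (Bool.if-eta (crosses y z))

      collapse : ∀ u v → ∑[ y < ∣V∣ H ] ∑[ z < ∣V∣ H ] F y z u v ≈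
        (if lookup (preimage f B) u ∧ not (lookup (preimage f B) v) then cap G u v else 0#)
      collapse u v = begin
        ∑[ y < ∣V∣ H ] ∑[ z < ∣V∣ H ] F y z u v
          ≈⟨ sum-single _ (f u) (λ y y≢fu → sum-zero _ λ z → F-zero y z u v
               (cong (_∧ does (f v Fin.≟ z)) (dec-false (f u Fin.≟ y) (y≢fu ∘ ≡.sym)))) ⟩
        ∑[ z < ∣V∣ H ] F (f u) z u v
          ≈⟨ sum-single _ (f v) (λ z z≢fv → F-zero (f u) z u v
               (≡.trans (cong (does (f u Fin.≟ f u) ∧_)
                              (dec-false (f v Fin.≟ z) (z≢fv ∘ ≡.sym)))
                        (Bool.∧-zeroʳ _))) ⟩
        F (f u) (f v) u v
          ≡⟨ cong (λ b → if crosses (f u) (f v) then (if b then cap G u v else 0#) else 0#)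
               (cong₂ _∧_ (dec-true (f u Fin.≟ f u) ≡.refl) (dec-true (f v Fin.≟ f v) ≡.refl)) ⟩
        (if crosses (f u) (f v) then cap G u v else 0#)
          ≡⟨ cong₂ (λ a b → if a ∧ not b then cap G u v else 0#)
               (Vec.lookup∘tabulate (lookup B ∘ f) u) (Vec.lookup∘tabulate (lookup B ∘ f) v) ⟨
        (if lookup (preimage f B) u ∧ not (lookup (preimage f B) v) then cap G u v else 0#) ∎

    h-K-contraction : ∀ U → h-K G U ≤ h-K H U
    h-K-contraction U =
      let B , B∩K≡U , hB≈ = h-K-attained H U
      in ≤-trans (h-K-≤ G (preimage f B) (≡.trans (preimage-∩K B) B∩K≡U))
                 (≤-reflexive (trans (sym (h-preimage B)) hB≈))

  -- The sparsifier preserves terminal cut values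

  sparsifier-mimicks : ∀ {k} {G H : Network R k} →
                       IsExactCutSparsifier R G H → IsMimickingNetwork R G H
  sparsifier-mimicks {k} {G} {H} sp U with nonempty? U ×-dec nonempty? (∁ U)
  -- For the empty set and for `K` both values are zero.
  ... | no ¬np =
    let _ , U≡b = ¬NonemptyProper⇒constant U ¬np
    in trans (h-K-constant H U U≡b) (sym (h-K-constant G U U≡b))
  ... | yes np = antisym
    (≤-trans (h-K-≤ H B B∩K≡U)
             (≤-reflexive (trans (h-preimage contraction B)
                                 (trans (reflexive (cong (h G) preimage≡cut)) (proj₂ minimum)))))
    (h-K-contraction contraction U)
    where
    open IsExactCutSparsifier sp

    minimum : IsMinimumTerminalCut G U (cut U)
    minimum = cut-minimum U np

    -- The chosen cut pushed forward to the nodes, reading the side of a cluster off the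
    -- representative that surjectivity supplies.
    B : Subset (∣V∣ H)
    B = tabulate λ y → lookup (cut U) (proj₁ (cluster-onto y))

    preimage≡cut : preimage cluster B ≡ cut U
    preimage≡cut = ≡.trans
      (Vec.tabulate-cong λ u → ≡.trans (Vec.lookup∘tabulate _ (cluster u))
        -- `u` and the representative of its cluster lie on the same side of `cut U`, so the choice
        -- of representative is harmless.
        (Equivalence.to (cluster-fibre _ u) (proj₂ (cluster-onto (cluster u)) ≡.refl) U np))
      (Vec.tabulate∘lookup (cut U))

    B∩K≡U : _∩K H B ≡ U
    B∩K≡U = ≡.trans (≡.sym (preimage-∩K contraction B))
                    (≡.trans (cong (_∩K G) preimage≡cut) (proj₁ minimum))

  -- Lower bound on the size of contraction-based networks

  preimage-minimum : ∀ {k} {G H : Network R k} {f} → IsContraction R G H f →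
                     IsMimickingNetwork R G H → ∀ {U B} →
                     IsMinimumTerminalCut H U B → IsMinimumTerminalCut G U (preimage f B)
  preimage-minimum contr mim {U} {B} (B∩K≡U , hB≈) =
    ≡.trans (preimage-∩K contr B) B∩K≡U ,
    trans (sym (h-preimage contr B)) (trans hB≈ (mim U))

  contraction-refines-clusters :
    ∀ {k} {G H : Network R k} → UniqueMinimumTerminalCuts G →
    (choice : MinimumTerminalCutChoice R G) →
    IsMimickingNetwork R G H → ∀ {f} → IsContraction R G H f →
    ∀ {u v} → f u ≡ f v → MinimumTerminalCutChoice.SameCluster choice u v
  contraction-refines-clusters {G = G} {H} unique choice mim {f} contr {u} {v} fu≡fv U np =
    ≡.trans (side u) (≡.trans (cong (lookup B) fu≡fv) (≡.sym (side v)))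
    where
    open MinimumTerminalCutChoice choice

    B : Subset (∣V∣ H)
    B = proj₁ (h-K-attained H U)

    cut≡preimage : cut U ≡ preimage f B
    cut≡preimage =
      let _ , _ , uniq = unique U np
      -- Both sets are minimum terminal cuts of `G` for `U`, hence both equal the unique one.
      in ≡.trans (≡.sym (uniq (cut-minimum U np)))
                 (uniq (preimage-minimum {H = H} contr mim {B = B} (proj₂ (h-K-attained H U))))

    side : ∀ w → lookup (cut U) w ≡ lookup B (f w)
    side w = ≡.trans (cong (λ A → lookup A w) cut≡preimage) (Vec.lookup∘tabulate _ w)

theorem1p2 : ∀ {c ℓ₁ ℓ₂} (R : OrderedField c ℓ₁ ℓ₂) {k} (G H : Network R k) →
    Network.UniqueMinimumTerminalCuts G →
    IsExactCutSparsifier R G H →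
    IsOptimalContractionBased R G H
theorem1p2 R G H unique sp =
  (sparsifier-mimicks R sp , cluster , contraction) ,
  -- Each node of `H` is sent to the image under `f` of a representative of its cluster. If two
  -- images agree, the representatives share a cluster, so the nodes coincide.
  λ H′ (mim , f , contr) → Fin.injective⇒≤ {f = λ y → f (proj₁ (cluster-onto y))} λ {y} {z} eq →
    ≡.trans (≡.sym (proj₂ (cluster-onto y) ≡.refl))
      (≡.trans
        (Equivalence.from (cluster-fibre _ _)
          (contraction-refines-clusters R unique choice mim contr eq))
        (proj₂ (cluster-onto z) ≡.refl))
  where open IsExactCutSparsifier sp
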